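{- Suppose that either (i) $n=2t$ and $2^{n-1}<N\le 2^{n-1}+\tfrac12\binom{n}{t}-t$, or (ii) $n=2t+1$ and $2^{n-1}<N\le 2^{n-1}+\binom{n-1}{t-1}-t-1$. Then there exists a family $\mathcal{A}\subset\mathcal{P}([n])$ of size $N$ which, for every $s$, contains the maximal number of intersecting subfamilies of size $s$ among all families in $\mathcal{P}([n])$ of size $N$, and which is not of the form $[n]^{(\ge t+1)}\cup\mathcal{B}$ for any $\mathcal{B}\subset[n]^{(t)}$.
   Context: $[n]=\{1,\dots,n\}$, $\mathcal{P}([n])$ its power set, $[n]^{(t)}$ the $t$-element subsets, $[n]^{(\ge t)}$ the subsets of size at least $t$. A family is intersecting if any two of its members have nonempty intersection. -}

module Defs where

open import Data.Nat using (ℕ; zero; suc)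
open import Data.List using (List; []; _∷_; map; _++_; length; filter)
open import Data.List.Relation.Unary.All using (All; all?)
open import Data.Fin.Subset using (Subset; _∩_; Nonempty)
open import Data.Fin.Subset.Properties using (nonempty?)
open import Relation.Nullary using (Dec)

-- A family 𝒜 ⊂ 𝒫([n]) is represented as a duplicate-free list of subsets
-- (Subset n = characteristic vectors over Fin n ≅ [n]).

-- All s-element sublists (combinations) of a list.  For a duplicate-free
-- list this lists every s-element subfamily exactly once.
choose : ∀ {a} {A : Set a} → ℕ → List A → List (List A)
choose zero    _        = [] ∷ []
choose (suc k) []       = []
choose (suc k) (x ∷ xs) = map (x ∷_) (choose k xs) ++ choose (suc k) xs

Intersecting : ∀ {n} → List (Subset n) → Set
Intersecting F = All (λ X → All (λ Y → Nonempty (X ∩ Y)) F) F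

intersecting? : ∀ {n} (F : List (Subset n)) → Dec (Intersecting F)
intersecting? F = all? (λ X → all? (λ Y → nonempty? (X ∩ Y)) F) F

numIntersecting : ∀ {n} → ℕ → List (Subset n) → ℕ
numIntersecting s F = length (filter intersecting? (choose s F))

{-# OPTIONS --safe #-}
module Submission where

-- A class {X , ∁ X} contributes at most one member to an intersecting family, so the
-- s-element intersecting subfamilies of ℱ number at most the s-th elementary symmetric
-- function of the numbers |ℱ ∩ {X , ∁ X}| ∈ {0 , 1 , 2}.  For a given |ℱ| ≥ 2ⁿ⁻¹ this is
-- largest when no class is missed, since 1 + 2x ≤ (1 + x)² coefficientwise, and the bound
-- is attained if moreover any two disjoint members are complementary.
--
-- Such a family containing a (t ∸ 1)-set Y through the first point 0 arises as follows.
-- Choose X from each class {X , ∁ X} with 0 ∈ X if Y ⊆ X or t < |X|, and ∁ X otherwise;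
-- then add ∁ Y, and any number of t-sets through 0 that do not contain Y.

open import Defs
open import Data.Nat using (ℕ; zero; suc; _+_; _*_; _∸_; _^_; _≤_; _<_; _≤?_; z≤n; s≤s)
open import Data.Nat.Combinatorics using (_C_; nC1≡n; nCn≡1; nCk≡nC[n∸k]; nCk+nC[k+1]≡[n+1]C[k+1]; k>n⇒nCk≡0)
open import Data.Nat.ListAction using (sum)
open import Data.Nat.ListAction.Properties using (sum-++)
open import Data.Nat.Properties
open import Data.Nat.Tactic.RingSolver using (solve-∀)
open import Data.Bool as Bool using (Bool; true; false; not; if_then_else_)
open import Data.Bool.Properties using (not-involutive)
open import Data.Empty using (⊥-elim)
open import Data.Fin using (zero; suc)
open import Data.Fin.Subset using (Subset; inside; outside; _∉_; _⊆_; _⊈_; _∩_; ∁; ⊥; Nonempty; ∣_∣)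
open import Data.Fin.Subset.Properties as Subset using (nonempty?; _⊆?_; ⊆-refl; ⊆-trans; ⊆-antisym; drop-∷-⊆; ∣⊥∣≡0; ∣∁p∣≡n∸∣p∣; p⊆q⇒∣p∣≤∣q∣; p⊂q⇒∣p∣<∣q∣; x∈p∩q⁺; x∈p∩q⁻; x∉p⇒x∈∁p; x∈∁p⇒x∉p; ∩-comm)
open import Data.List using (List; []; _∷_; _++_; length; map; filter; take; concat; concatMap)
open import Data.List.Properties using (length-filter; filter-some; map-++; map-∘; length-++; length-map; length-take)
open import Data.List.Membership.Propositional using (_∈_; lose)
open import Data.List.Membership.Propositional.Properties using (∈-map⁺; ∈-map⁻; ∈-++⁺ˡ; ∈-++⁺ʳ; ∈-++⁻; ∈-concat⁺′; ∈-concat⁻′; ∈-filter⁺; ∈-filter⁻)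
open import Data.List.Membership.Propositional.Properties.WithK using (unique∧set⇒bag)
import Data.List.Membership.DecPropositional as DecMembership
open import Data.List.Relation.Unary.All as All using (All; []; _∷_)
import Data.List.Relation.Unary.All.Properties as All
open import Data.List.Relation.Unary.AllPairs as AllPairs using (AllPairs; []; _∷_)
import Data.List.Relation.Unary.AllPairs.Properties as AllPairs
open import Data.List.Relation.Unary.Any using (here; there)
open import Data.List.Relation.Unary.Unique.Propositional using (Unique)
import Data.List.Relation.Unary.Unique.Propositional.Properties as Unique
import Data.List.Relation.Unary.Unique.DecPropositional as DecUnique
open import Data.List.Relation.Binary.BagAndSetEquality using (∼bag⇒↭)
open import Data.List.Relation.Binary.Disjoint.Propositional using (Disjoint)
open import Data.List.Relation.Binary.Permutation.Propositional using (_↭_; refl; prep; swap; trans; ↭⇒↭ₛ; ↭-sym)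
open import Data.List.Relation.Binary.Permutation.Propositional.Properties using (↭-length) renaming (map⁺ to ↭-map⁺)
import Data.List.Relation.Binary.Permutation.Setoid.Properties as ↭ₛ
open import Data.List.Relation.Binary.Sublist.Propositional as Sublist using ([]; _∷_; _∷ʳ_) renaming (_⊆_ to _⊑_)
open import Data.List.Relation.Binary.Sublist.Propositional.Properties using (All-resp-⊆)
open import Data.Product using (_×_; _,_; proj₁; proj₂; ∃-syntax)
open import Data.Sum using (_⊎_; inj₁; inj₂; [_,_]′)
open import Data.Vec using ([]; _∷_; here; there)
open import Data.Vec.Properties using (≡-dec; ∷-injectiveʳ)
open import Function using (_∘_; id; mk⇔)
open import Function.Bundles using (_⇔_; Equivalence)
open import Relation.Binary using (DecidableEquality)
open import Relation.Binary.PropositionalEquality using (_≡_; _≢_; _≗_; refl; sym; cong; cong₂; subst; setoid; module ≡-Reasoning) renaming (trans to ≡-trans)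
open import Relation.Nullary using (¬_; Dec; yes; no; does; contradiction)
open import Relation.Nullary.Decidable using (_⊎-dec_; dec-true; decidable-stable)
open import Relation.Unary using (Pred; Decidable)

private variable
  A B : Set
  P Q : Set
  m k r : ℕ

-- Weighted counting of sublists

𝟙 : Dec P → ℕ
𝟙 p = if does p then 1 else 0

𝟙-mono : (p : Dec P) (q : Dec Q) → (P → Q) → 𝟙 p ≤ 𝟙 q
𝟙-mono (yes _) (yes _) _ = ≤-refl
𝟙-mono (yes p) (no ¬q) f = contradiction (f p) ¬q
𝟙-mono (no _)  _       _ = z≤n

𝟙-cong : (p : Dec P) (q : Dec Q) → (P → Q) → (Q → P) → 𝟙 p ≡ 𝟙 q
𝟙-cong p q f g = ≤-antisym (𝟙-mono p q f) (𝟙-mono q p g)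

𝟙-no : (p : Dec P) → ¬ P → 𝟙 p ≡ 0
𝟙-no (yes p) ¬p = contradiction p ¬p
𝟙-no (no _)  _  = refl

-- The summand is arbitrary so that a chosen head can be absorbed into it: `f ∘ (x ∷_)` again has
-- the right type, and inductions on the list close.
weight : (List A → ℕ) → ℕ → List A → ℕ
weight f s xs = sum (map f (choose s xs))

length-filter-𝟙 : {R : Pred A _} (R? : Decidable R) (xs : List A) →
  length (filter R? xs) ≡ sum (map (𝟙 ∘ R?) xs)
length-filter-𝟙 R? [] = refl
length-filter-𝟙 R? (x ∷ xs) with R? x
... | yes _ = cong suc (length-filter-𝟙 R? xs)
... | no _  = length-filter-𝟙 R? xs

weight-suc : (f : List A → ℕ) (s : ℕ) (x : A) (xs : List A) →
  weight f (suc s) (x ∷ xs) ≡ weight (f ∘ (x ∷_)) s xs + weight f (suc s) xs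
weight-suc f s x xs = begin
  sum (map f (map (x ∷_) (choose s xs) ++ choose (suc s) xs))
    ≡⟨ cong sum (map-++ f (map (x ∷_) (choose s xs)) _) ⟩
  sum (map f (map (x ∷_) (choose s xs)) ++ map f (choose (suc s) xs))
    ≡⟨ sum-++ (map f (map (x ∷_) (choose s xs))) _ ⟩
  sum (map f (map (x ∷_) (choose s xs))) + weight f (suc s) xs
    ≡⟨ cong (λ ys → sum ys + _) (map-∘ (choose s xs)) ⟨
  weight (f ∘ (x ∷_)) s xs + weight f (suc s) xs ∎
  where open ≡-Reasoning

-- Comparing only on sublists of `xs` is what lets properties of the whole family, such as `Unique`,
-- be used for each subfamily.
weight-mono : {f g : List A → ℕ} (s : ℕ) (xs : List A) →
  (∀ {G} → G ⊑ xs → f G ≤ g G) → weight f s xs ≤ weight g s xs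
weight-mono zero xs f≤g = +-monoˡ-≤ 0 (f≤g (Sublist.minimum xs))
weight-mono (suc s) [] f≤g = z≤n
weight-mono {f = f} {g} (suc s) (x ∷ xs) f≤g
  rewrite weight-suc f s x xs | weight-suc g s x xs =
  +-mono-≤ (weight-mono s xs (f≤g ∘ (refl ∷_)))
           (weight-mono (suc s) xs (f≤g ∘ (x ∷ʳ_)))

weight-cong : {f g : List A → ℕ} (s : ℕ) (xs : List A) →
  (∀ {G} → G ⊑ xs → f G ≡ g G) → weight f s xs ≡ weight g s xs
weight-cong s xs f≡g = ≤-antisym
  (weight-mono s xs (≤-reflexive ∘ f≡g))
  (weight-mono s xs (≤-reflexive ∘ sym ∘ f≡g))

weight-zero : {f : List A → ℕ} (s : ℕ) (xs : List A) →
  (∀ G → f G ≡ 0) → weight f s xs ≡ 0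
weight-zero zero xs f≡0 = ≡-trans (+-identityʳ _) (f≡0 [])
weight-zero (suc s) [] f≡0 = refl
weight-zero {f = f} (suc s) (x ∷ xs) f≡0
  rewrite weight-suc f s x xs
        | weight-zero s xs (f≡0 ∘ (x ∷_)) = weight-zero (suc s) xs f≡0

-- Permuting `xs` also permutes each chosen sublist internally, hence the invariance asked of `f`.
weight-↭ : {f : List A → ℕ} → (∀ {G H} → G ↭ H → f G ≡ f H) →
  ∀ s {xs ys} → xs ↭ ys → weight f s xs ≡ weight f s ys
weight-↭ resp zero _ = refl
weight-↭ resp (suc s) refl = refl
weight-↭ {f = f} resp (suc s) (prep {xs} {ys} x p)
  rewrite weight-suc f s x xs | weight-suc f s x ys =
  cong₂ _+_ (weight-↭ (resp ∘ prep x) s p) (weight-↭ resp (suc s) p)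
weight-↭ {f = f} resp (suc zero) (swap {xs} {ys} x y p)
  rewrite weight-suc f 0 x (y ∷ xs) | weight-suc f 0 y xs
        | weight-suc f 0 y (x ∷ ys) | weight-suc f 0 x ys
        | weight-↭ {f = f} resp 1 p = exchange (f (x ∷ []) + 0) (f (y ∷ []) + 0) _
  where
  exchange : ∀ a b c → a + (b + c) ≡ b + (a + c)
  exchange = solve-∀
-- Sublists are sorted by which of `x` and `y` they contain. Those with both are where `f` must
-- ignore the order of the two heads; in size one, treated separately, there are none.
weight-↭ {f = f} resp (suc (suc s)) (swap {xs} {ys} x y p)
  rewrite weight-suc f (suc s) x (y ∷ xs) | weight-suc f (suc s) y xs
        | weight-suc f (suc s) y (x ∷ ys) | weight-suc f (suc s) x ys
        | weight-suc (f ∘ (x ∷_)) s y xs | weight-suc (f ∘ (y ∷_)) s x ys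
        | weight-↭ {f = f} resp (2 + s) p
        | weight-↭ (resp ∘ prep x) (suc s) p
        | weight-↭ (resp ∘ prep y) (suc s) p
        | weight-↭ (λ q → resp (prep x (prep y q))) s p
        | weight-cong s ys (λ {G} _ → resp (swap x y (refl {xs = G}))) =
  exchange (weight (f ∘ (y ∷_) ∘ (x ∷_)) s ys) _ _ _
  where
  exchange : ∀ a b c d → a + b + (c + d) ≡ a + c + (b + d)
  exchange = solve-∀
weight-↭ resp s@(suc _) (trans p q) =
  ≡-trans (weight-↭ resp s p) (weight-↭ resp s q)

-- Elementary symmetric functions of small multiplicities; power series are coefficient functions

times[1+_x] : ℕ → (ℕ → ℕ) → ℕ → ℕ
times[1+ a x] f zero    = f zero
times[1+ a x] f (suc s) = a * f s + f (suc s)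

esym : List ℕ → ℕ → ℕ
esym []       zero    = 1
esym []       (suc _) = 0
esym (a ∷ as)         = times[1+ a x] (esym as)

times-cong : ∀ a {f g : ℕ → ℕ} → f ≗ g → times[1+ a x] f ≗ times[1+ a x] g
times-cong a f≗g zero    = f≗g zero
times-cong a f≗g (suc s) = cong₂ (λ u v → a * u + v) (f≗g s) (f≗g (suc s))

times-comm : ∀ a b (f : ℕ → ℕ) →
  times[1+ a x] (times[1+ b x] f) ≗ times[1+ b x] (times[1+ a x] f)
times-comm a b f zero = refl
times-comm a b f (suc zero) = lemma a b (f 0) (f 1)
  where
  lemma : ∀ a b u v → a * u + (b * u + v) ≡ b * u + (a * u + v)
  lemma = solve-∀
times-comm a b f (suc (suc s)) = lemma a b (f s) (f (suc s)) (f (2 + s))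
  where
  lemma : ∀ a b u v w → a * (b * u + v) + (b * v + w) ≡ b * (a * u + v) + (a * v + w)
  lemma = solve-∀

times0 : (f : ℕ → ℕ) → times[1+ 0 x] f ≗ f
times0 f zero    = refl
times0 f (suc s) = refl

-- The coefficients of (1 + 2x)ᵖ (1 + x)^q.
coeff : ℕ → ℕ → ℕ → ℕ
coeff zero    zero    = esym []
coeff zero    (suc q) = times[1+ 1 x] (coeff zero q)
coeff (suc p) q       = times[1+ 2 x] (coeff p q)

-- `coeff` keeps the factors 1 + 2x outermost, so a new factor 1 + x has to be commuted past them.
times1-coeff : ∀ p q → times[1+ 1 x] (coeff p q) ≗ coeff p (suc q)
times1-coeff zero    q s = refl
times1-coeff (suc p) q s = begin
  times[1+ 1 x] (times[1+ 2 x] (coeff p q)) s ≡⟨ times-comm 1 2 (coeff p q) s ⟩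
  times[1+ 2 x] (times[1+ 1 x] (coeff p q)) s ≡⟨ times-cong 2 (times1-coeff p q) s ⟩
  coeff (suc p) (suc q) s ∎
  where open ≡-Reasoning

-- 1 + 2x is coefficientwise at most (1 + x)².
coeff-split : ∀ p q s → coeff (suc p) q s ≤ coeff p (2 + q) s
coeff-split p q s = begin
  times[1+ 2 x] f s                  ≤⟨ split s ⟩
  times[1+ 1 x] (times[1+ 1 x] f) s  ≡⟨ times-cong 1 (times1-coeff p q) s ⟩
  times[1+ 1 x] (coeff p (suc q)) s  ≡⟨ times1-coeff p (suc q) s ⟩
  coeff p (2 + q) s ∎
  where
  open ≤-Reasoning
  f = coeff p q

  step : ∀ s → f s ≤ times[1+ 1 x] f s
  step zero    = ≤-refl
  step (suc s) = m≤n+m _ _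

  regroup : ∀ u v → 2 * u + v ≡ 1 * u + (1 * u + v)
  regroup = solve-∀

  split : ∀ s → times[1+ 2 x] f s ≤ times[1+ 1 x] (times[1+ 1 x] f) s
  split zero    = ≤-refl
  split (suc s) = begin
    2 * f s + f (suc s)             ≡⟨ regroup (f s) (f (suc s)) ⟩
    1 * f s + (1 * f s + f (suc s)) ≤⟨ +-monoˡ-≤ _ (*-monoʳ-≤ 1 (step s)) ⟩
    1 * times[1+ 1 x] f s + (1 * f s + f (suc s)) ∎

-- Here `z` counts missed classes. Each is traded together with a class of multiplicity 2 for two
-- classes of multiplicity 1, which preserves both the number of classes and the total.
coeff-balance : ∀ z p q s → coeff (z + p) q s ≤ coeff p (z + z + q) s
coeff-balance zero    p q s = ≤-refl
coeff-balance (suc z) p q s = begin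
  coeff (suc (z + p)) q s     ≤⟨ coeff-split (z + p) q s ⟩
  coeff (z + p) (2 + q) s     ≤⟨ coeff-balance z p (2 + q) s ⟩
  coeff p (z + z + (2 + q)) s ≡⟨ cong (λ k → coeff p k s) (shift z q) ⟩
  coeff p (suc z + suc z + q) s ∎
  where
  open ≤-Reasoning
  shift : ∀ z q → z + z + (2 + q) ≡ suc z + suc z + q
  shift = solve-∀

-- A zero multiplicity contributes the factor 1, so `esym` depends only on the numbers of twos and
-- ones; the zeros are still visible in the length.
record Profile (as : List ℕ) : Set where
  field
    twos ones zeros : ℕ
    sum≡    : sum as ≡ 2 * twos + ones
    length≡ : length as ≡ twos + ones + zeros
    esym≗   : esym as ≗ coeff twos ones
    full    : All (1 ≤_) as → zeros ≡ 0

profile : ∀ {as} → All (_≤ 2) as → Profile as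
profile [] = record
  { twos = 0; ones = 0; zeros = 0 ; sum≡ = refl; length≡ = refl
  ; esym≗ = λ _ → refl ; full = λ _ → refl }
profile {0 ∷ as} (_ ∷ as≤2) = record
  { twos = twos; ones = ones; zeros = suc zeros
  ; sum≡ = sum≡
  ; length≡ = ≡-trans (cong suc length≡) (sym (+-suc _ zeros))
  ; esym≗ = λ s → ≡-trans (times0 (esym as) s) (esym≗ s)
  ; full = λ { (() ∷ _) } }
  where open Profile (profile as≤2)
profile {1 ∷ as} (_ ∷ as≤2) = record
  { twos = twos; ones = suc ones; zeros = zeros
  ; sum≡ = ≡-trans (cong suc sum≡) (sym (+-suc _ ones))
  ; length≡ = ≡-trans (cong suc length≡) (cong (_+ zeros) (sym (+-suc twos ones)))
  ; esym≗ = λ s → ≡-trans (times-cong 1 esym≗ s) (times1-coeff twos ones s)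
  ; full = λ { (_ ∷ 1≤as) → full 1≤as } }
  where open Profile (profile as≤2)
profile {2 ∷ as} (_ ∷ as≤2) = record
  { twos = suc twos; ones = ones; zeros = zeros
  ; sum≡ = ≡-trans (cong (2 +_) sum≡) (cong (λ k → suc (k + ones)) (sym (+-suc twos _)))
  ; length≡ = cong suc length≡
  ; esym≗ = times-cong 2 esym≗
  ; full = λ { (_ ∷ 1≤as) → full 1≤as } }
  where open Profile (profile as≤2)
profile {suc (suc (suc _)) ∷ _} (s≤s (s≤s ()) ∷ _)

-- Since `bs` has no zeros, equal lengths and sums determine its profile from that of `as`: the
-- zeros of `as` and equally many of its twos have been replaced by ones. This is the exchange of
-- `coeff-balance`.
esym-balanced : ∀ {as bs} → All (_≤ 2) as → All (_≤ 2) bs → All (1 ≤_) bs →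
  length as ≡ length bs → sum as ≡ sum bs → ∀ s → esym as s ≤ esym bs s
esym-balanced {as} {bs} as≤2 bs≤2 1≤bs len≡ sum≡ s = begin
  esym as s                              ≡⟨ α.esym≗ s ⟩
  coeff α.twos α.ones s                  ≡⟨ cong (λ k → coeff k α.ones s) twos≡ ⟩
  coeff (α.zeros + β.twos) α.ones s      ≤⟨ coeff-balance α.zeros β.twos α.ones s ⟩
  coeff β.twos (α.zeros + α.zeros + α.ones) s
                                         ≡⟨ cong (λ k → coeff β.twos k s) ones≡ ⟩
  coeff β.twos β.ones s                  ≡⟨ β.esym≗ s ⟨
  esym bs s ∎
  where
  open ≤-Reasoning
  module α = Profile (profile as≤2)
  module β = Profile (profile bs≤2)

  len : α.twos + α.ones + α.zeros ≡ β.twos + β.ones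
  len = begin-equality
    α.twos + α.ones + α.zeros ≡⟨ α.length≡ ⟨
    length as                 ≡⟨ len≡ ⟩
    length bs                 ≡⟨ β.length≡ ⟩
    β.twos + β.ones + β.zeros ≡⟨ cong (β.twos + β.ones +_) (β.full 1≤bs) ⟩
    β.twos + β.ones + 0       ≡⟨ +-identityʳ _ ⟩
    β.twos + β.ones ∎

  tot : 2 * α.twos + α.ones ≡ 2 * β.twos + β.ones
  tot = begin-equality
    2 * α.twos + α.ones ≡⟨ α.sum≡ ⟨
    sum as              ≡⟨ sum≡ ⟩
    sum bs              ≡⟨ β.sum≡ ⟩
    2 * β.twos + β.ones ∎

  regroup₁ : ∀ p q → p + (p + q) ≡ 2 * p + q
  regroup₁ = solve-∀
  regroup₂ : ∀ p a b z → p + (a + b + z) ≡ z + p + (a + b)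
  regroup₂ = solve-∀
  regroup₃ : ∀ p z q → 2 * p + (z + z + q) ≡ 2 * (z + p) + q
  regroup₃ = solve-∀

  -- The sum minus the length equals the number of twos minus the number of zeros; cancellation
  -- avoids the subtraction.
  twos≡ : α.twos ≡ α.zeros + β.twos
  twos≡ = +-cancelʳ-≡ (α.twos + α.ones) _ _ (begin-equality
    α.twos + (α.twos + α.ones)             ≡⟨ regroup₁ α.twos α.ones ⟩
    2 * α.twos + α.ones                    ≡⟨ tot ⟩
    2 * β.twos + β.ones                    ≡⟨ regroup₁ β.twos β.ones ⟨
    β.twos + (β.twos + β.ones)             ≡⟨ cong (β.twos +_) len ⟨
    β.twos + (α.twos + α.ones + α.zeros)   ≡⟨ regroup₂ β.twos α.twos α.ones α.zeros ⟩
    α.zeros + β.twos + (α.twos + α.ones) ∎)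

  ones≡ : α.zeros + α.zeros + α.ones ≡ β.ones
  ones≡ = +-cancelˡ-≡ (2 * β.twos) _ _ (begin-equality
    2 * β.twos + (α.zeros + α.zeros + α.ones) ≡⟨ regroup₃ β.twos α.zeros α.ones ⟩
    2 * (α.zeros + β.twos) + α.ones           ≡⟨ cong (λ k → 2 * k + α.ones) twos≡ ⟨
    2 * α.twos + α.ones                       ≡⟨ tot ⟩
    2 * β.twos + β.ones ∎)

-- Rainbow sublists

module Rainbow (_≟_ : DecidableEquality B) (κ : A → B) where

  -- Below, `κ` sends a set to the index of its complementary pair, so a rainbow list takes at most
  -- one member from each pair.
  rainbow? : Decidable (λ G → Unique (map κ G))
  rainbow? G = DecUnique.unique? _≟_ (map κ G)

  rainbow : List A → ℕ
  rainbow = 𝟙 ∘ rainbow?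

  rainbow-↭ : ∀ {G H} → G ↭ H → rainbow G ≡ rainbow H
  rainbow-↭ {G} {H} p = 𝟙-cong (rainbow? G) (rainbow? H)
    (↭ₛ.Unique-resp-↭ (setoid B) (↭⇒↭ₛ (↭-map⁺ κ p)))
    (↭ₛ.Unique-resp-↭ (setoid B) (↭⇒↭ₛ (↭-map⁺ κ (↭-sym p))))

  -- A rainbow sublist uses either no element of `xs` or exactly one of them, and this choice does
  -- not restrict what is taken from `R`. Hence the factor 1 + ax with a the length of `xs`.
  weight-rainbow-block : ∀ b {xs R} → All (λ x → κ x ≡ b) xs → All (λ x → b ≢ κ x) R →
    ∀ s →
    weight rainbow s (xs ++ R) ≡ times[1+ length xs x] (λ k → weight rainbow k R) s
  weight-rainbow-block b xs=b R≠b zero = refl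
  weight-rainbow-block b [] R≠b (suc s) = refl
  weight-rainbow-block b {x ∷ xs} {R} (x=b ∷ xs=b) R≠b (suc s) = begin
    weight rainbow (suc s) (x ∷ xs ++ R)
      ≡⟨ weight-suc rainbow s x (xs ++ R) ⟩
    weight (rainbow ∘ (x ∷_)) s (xs ++ R) + weight rainbow (suc s) (xs ++ R)
      ≡⟨ cong₂ _+_ (skip xs=b s) (weight-rainbow-block b xs=b R≠b (suc s)) ⟩
    weight rainbow s R + (length xs * weight rainbow s R + weight rainbow (suc s) R)
      ≡⟨ +-assoc (weight rainbow s R) _ _ ⟨
    suc (length xs) * weight rainbow s R + weight rainbow (suc s) R ∎
    where
    open ≡-Reasoning
    -- Once `x` is chosen, the other elements of its colour can only spoil the rainbow property, so
    -- they may be deleted.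
    skip : ∀ {ys} → All (λ y → κ y ≡ b) ys → ∀ s →
      weight (rainbow ∘ (x ∷_)) s (ys ++ R) ≡ weight rainbow s R
    skip [] s = weight-cong s R λ {G} G⊑R → 𝟙-cong (rainbow? (x ∷ G)) (rainbow? G) AllPairs.tail
      (All.map⁺ (All.map (λ b≢ x≡ → b≢ (≡-trans (sym x=b) x≡)) (All-resp-⊆ G⊑R R≠b)) ∷_)
    skip (_ ∷ _) zero = refl
    skip {y ∷ ys} (y=b ∷ ys=b) (suc s) = begin
      weight (rainbow ∘ (x ∷_)) (suc s) (y ∷ ys ++ R)
        ≡⟨ weight-suc (rainbow ∘ (x ∷_)) s y (ys ++ R) ⟩
      weight (rainbow ∘ (x ∷_) ∘ (y ∷_)) s (ys ++ R) + weight (rainbow ∘ (x ∷_)) (suc s) (ys ++ R)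
        ≡⟨ cong₂ _+_
             (weight-zero s (ys ++ R) λ G → 𝟙-no (rainbow? (x ∷ y ∷ G)) λ { ((x≢y ∷ _) ∷ _) → x≢y (≡-trans x=b (sym y=b)) })
             (skip ys=b (suc s)) ⟩
      weight rainbow (suc s) R ∎

  weight-rainbow-blocks : (block : B → List A) → (∀ b → All (λ x → κ x ≡ b) (block b)) →
    ∀ {bs} → Unique bs → ∀ s →
    weight rainbow s (concatMap block bs) ≡ esym (map (length ∘ block) bs) s
  weight-rainbow-blocks block mono [] zero = refl
  weight-rainbow-blocks block mono [] (suc s) = refl
  weight-rainbow-blocks block mono {b ∷ bs} (b∉bs ∷ bs!) s = begin
    weight rainbow s (block b ++ concatMap block bs)
      ≡⟨ weight-rainbow-block b (mono b)
           (All.concat⁺ (All.map⁺ (All.map (λ b≢b′ → All.map (λ x=b′ b≡ → b≢b′ (≡-trans b≡ x=b′)) (mono _)) b∉bs)))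
           s ⟩
    times[1+ length (block b) x] (λ k → weight rainbow k (concatMap block bs)) s
      ≡⟨ times-cong (length (block b)) (weight-rainbow-blocks block mono bs!) s ⟩
    esym (map (length ∘ block) (b ∷ bs)) s ∎
    where open ≡-Reasoning

-- Auxiliary facts on lists, and the enumeration of all subsets.

AllPairs-⊑ : {_~_ : A → A → Set} {xs ys : List A} → xs ⊑ ys → AllPairs _~_ ys → AllPairs _~_ xs
AllPairs-⊑ []        []         = []
AllPairs-⊑ (_ ∷ʳ τ)  (_ ∷ ys~)  = AllPairs-⊑ τ ys~
AllPairs-⊑ (refl ∷ τ) (y~ ∷ ys~) = All-resp-⊆ τ y~ ∷ AllPairs-⊑ τ ys~

unique-map-injective : (f : A → B) {xs : List A} → Unique (map f xs) →
  ∀ {x y} → x ∈ xs → y ∈ xs → f x ≡ f y → x ≡ y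
unique-map-injective f _ (here refl) (here refl) _ = refl
unique-map-injective f (x∉ ∷ _) (here refl) (there y∈) fx≡fy =
  contradiction fx≡fy (All.lookup x∉ (∈-map⁺ f y∈))
unique-map-injective f (y∉ ∷ _) (there x∈) (here refl) fx≡fy =
  contradiction (sym fx≡fy) (All.lookup y∉ (∈-map⁺ f x∈))
unique-map-injective f (_ ∷ xs!) (there x∈) (there y∈) = unique-map-injective f xs! x∈ y∈

length-concat : (xss : List (List A)) → length (concat xss) ≡ sum (map length xss)
length-concat []         = refl
length-concat (xs ∷ xss) = ≡-trans (length-++ xs) (cong (length xs +_) (length-concat xss))

∁-involutive : (Z : Subset m) → ∁ (∁ Z) ≡ Z
∁-involutive []      = refl
∁-involutive (b ∷ Z) = cong₂ _∷_ (not-involutive b) (∁-involutive Z)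

branch : List (Subset m) → List (Subset m) → List (Subset (suc m))
branch 𝒳 𝒴 = map (inside ∷_) 𝒳 ++ map (outside ∷_) 𝒴

branch-unique : {𝒳 𝒴 : List (Subset m)} → Unique 𝒳 → Unique 𝒴 → Unique (branch 𝒳 𝒴)
branch-unique 𝒳! 𝒴! = Unique.++⁺ (Unique.map⁺ ∷-injectiveʳ 𝒳!) (Unique.map⁺ ∷-injectiveʳ 𝒴!) disjoint
  where
  disjoint : Disjoint (map (inside ∷_) _) (map (outside ∷_) _)
  disjoint (X∈ , X∈′) with ∈-map⁻ (inside ∷_) X∈ | ∈-map⁻ (outside ∷_) X∈′
  ... | _ , _ , refl | _ , _ , ()

branch-length : (𝒳 𝒴 : List (Subset m)) → length (branch 𝒳 𝒴) ≡ length 𝒳 + length 𝒴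
branch-length 𝒳 𝒴 = ≡-trans (length-++ (map (inside ∷_) 𝒳))
  (cong₂ _+_ (length-map (inside ∷_) 𝒳) (length-map (outside ∷_) 𝒴))

subsets : ∀ m → List (Subset m)
subsets zero    = [] ∷ []
subsets (suc m) = branch (subsets m) (subsets m)

subsets-unique : ∀ m → Unique (subsets m)
subsets-unique zero    = [] ∷ []
subsets-unique (suc m) = branch-unique (subsets-unique m) (subsets-unique m)

subsets-complete : (Z : Subset m) → Z ∈ subsets m
subsets-complete []            = here refl
subsets-complete (inside ∷ Z)  = ∈-++⁺ˡ (∈-map⁺ (inside ∷_) (subsets-complete Z))
subsets-complete (outside ∷ Z) = ∈-++⁺ʳ _ (∈-map⁺ (outside ∷_) (subsets-complete Z))

subsets-length : ∀ m → length (subsets m) ≡ 2 ^ m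
subsets-length zero    = refl
subsets-length (suc m) = begin
  length (subsets (suc m))                ≡⟨ branch-length (subsets m) (subsets m) ⟩
  length (subsets m) + length (subsets m) ≡⟨ cong₂ _+_ (subsets-length m) (subsets-length m) ⟩
  2 ^ m + 2 ^ m                           ≡⟨ cong (2 ^ m +_) (+-identityʳ (2 ^ m)) ⟨
  2 ^ suc m ∎
  where open ≡-Reasoning

-- Complementary pairs {X , ∁ X} are indexed by their member containing the first point.

embed : Bool → Subset m → Subset (suc m)
embed true  Z = inside ∷ Z
embed false Z = outside ∷ ∁ Z

κ : Subset (suc m) → Subset m
κ (inside ∷ Z)  = Z
κ (outside ∷ Z) = ∁ Z

κ-embed : ∀ b (Z : Subset m) → κ (embed b Z) ≡ Z
κ-embed true  Z = refl
κ-embed false Z = ∁-involutive Z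

embed-κ : (X : Subset (suc m)) → ∃[ b ] X ≡ embed b (κ X)
embed-κ (inside ∷ Z)  = true , refl
embed-κ (outside ∷ Z) = false , cong (outside ∷_) (sym (∁-involutive Z))

-- Two sets with the same index are equal or complementary, and complementary sets are disjoint.
meeting⇒same : {X Y : Subset (suc m)} → Nonempty (X ∩ Y) → κ X ≡ κ Y → X ≡ Y
meeting⇒same {X = inside ∷ Z}  {inside ∷ Z′}  _ refl = refl
meeting⇒same {X = outside ∷ Z} {outside ∷ Z′} _ eq   =
  cong (outside ∷_) (≡-trans (sym (∁-involutive Z)) (≡-trans (cong ∁ eq) (∁-involutive Z′)))
meeting⇒same {X = inside ∷ Z}  {outside ∷ Z′} (_ , there x∈) refl =
  contradiction (proj₂ both) (x∈∁p⇒x∉p (proj₁ both))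
  where both = x∈p∩q⁻ _ Z′ x∈
meeting⇒same {X = outside ∷ Z} {inside ∷ Z′}  (_ , there x∈) refl =
  contradiction (proj₁ both) (x∈∁p⇒x∉p (proj₂ both))
  where both = x∈p∩q⁻ Z _ x∈

-- Intersecting subfamilies versus rainbow ones, and a criterion for optimality.

module _ {m : ℕ} where

  open Rainbow (≡-dec Bool._≟_) (κ {m})
  open DecMembership (≡-dec {n = suc m} Bool._≟_) using (_∈?_)

  private variable
    F G : List (Subset (suc m))

  numIntersecting-weight : ∀ s F → numIntersecting s F ≡ weight (𝟙 ∘ intersecting? {suc m}) s F
  numIntersecting-weight s F = length-filter-𝟙 intersecting? (choose s F)

  intersecting⇒rainbow : Unique F → Intersecting F → Unique (map κ F)
  intersecting⇒rainbow F! F∩ = AllPairs.map⁺ (go F! (All.lookup ∘ All.lookup F∩))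
    where
    go : Unique F → (∀ {X} → X ∈ F → ∀ {Y} → Y ∈ F → Nonempty (X ∩ Y)) →
      AllPairs (λ X Y → κ X ≢ κ Y) F
    go []        _ = []
    go (X∉ ∷ F!) meet =
      All.tabulate (λ Y∈ κX≡κY → All.lookup X∉ Y∈ (meeting⇒same (meet (here refl) (there Y∈)) κX≡κY))
      ∷ go F! (λ X∈ Y∈ → meet (there X∈) (there Y∈))

  -- Disjoint members must be complementary. The case of `X` against itself is included, where only
  -- the first alternative is possible, so every member is nonempty, as `Intersecting` also demands.
  AlmostIntersecting : List (Subset (suc m)) → Set
  AlmostIntersecting F = ∀ {X Y} → X ∈ F → Y ∈ F → Nonempty (X ∩ Y) ⊎ (κ X ≡ κ Y × X ≢ Y)

  -- Two distinct members with the same index cannot both lie in a rainbow list, which leaves only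
  -- the first alternative.
  rainbow⇒intersecting : AlmostIntersecting F → Unique (map κ F) → Intersecting F
  rainbow⇒intersecting F≈ F-rainbow = All.tabulate λ X∈ → All.tabulate λ Y∈ →
    [ id
    , (λ (κ≡ , X≢Y) → contradiction (unique-map-injective κ F-rainbow X∈ Y∈ κ≡) X≢Y)
    ]′ (F≈ X∈ Y∈)

  numIntersecting≤rainbow : Unique F → ∀ s → numIntersecting s F ≤ weight rainbow s F
  numIntersecting≤rainbow {F} F! s rewrite numIntersecting-weight s F =
    weight-mono s F λ {G} G⊑F →
      𝟙-mono (intersecting? G) (rainbow? G) (intersecting⇒rainbow (AllPairs-⊑ G⊑F F!))

  rainbow≤numIntersecting : AlmostIntersecting F → ∀ s → weight rainbow s F ≤ numIntersecting s F
  rainbow≤numIntersecting {F} F≈ s rewrite numIntersecting-weight s F =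
    weight-mono s F λ {G} G⊑F →
      𝟙-mono (rainbow? G) (intersecting? G)
        (rainbow⇒intersecting (λ X∈ Y∈ → F≈ (Sublist.lookup G⊑F X∈) (Sublist.lookup G⊑F Y∈)))

  pair : Subset m → List (Subset (suc m))
  pair Z = embed true Z ∷ embed false Z ∷ []

  pair-κ : (Z : Subset m) → All (λ X → κ X ≡ Z) (pair Z)
  pair-κ Z = refl ∷ ∁-involutive Z ∷ []

  embed∈pair : ∀ b (Z : Subset m) → embed b Z ∈ pair Z
  embed∈pair true  Z = here refl
  embed∈pair false Z = there (here refl)

  -- Filtering the pair by membership in `F`, rather than `F` by index, makes it immediate that a
  -- fibre has at most two elements.
  fibre : List (Subset (suc m)) → Subset m → List (Subset (suc m))
  fibre F Z = filter (_∈? F) (pair Z)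

  fibre-κ : ∀ F Z → All (λ X → κ X ≡ Z) (fibre F Z)
  fibre-κ F Z = All.filter⁺ (_∈? F) (pair-κ Z)

  fibres : List (Subset (suc m)) → List (Subset (suc m))
  fibres F = concatMap (fibre F) (subsets m)

  fibres-unique : ∀ F → Unique (fibres F)
  fibres-unique F = Unique.concat⁺
    (All.map⁺ (All.universal (λ Z → Unique.filter⁺ (_∈? F) (((λ ()) ∷ []) ∷ [] ∷ [])) _))
    (AllPairs.map⁺ {f = fibre F} (AllPairs.map disjoint (subsets-unique m)))
    where
    disjoint : ∀ {Z Z′} → Z ≢ Z′ → Disjoint (fibre F Z) (fibre F Z′)
    disjoint Z≢Z′ (X∈ , X∈′) =
      Z≢Z′ (≡-trans (sym (All.lookup (fibre-κ F _) X∈)) (All.lookup (fibre-κ F _) X∈′))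

  -- Both lists are duplicate-free with the same members. The regrouped list consists of one block
  -- per colour, the shape that `weight-rainbow-blocks` evaluates.
  fibres-↭ : Unique F → F ↭ fibres F
  fibres-↭ {F} F! = ∼bag⇒↭ (unique∧set⇒bag F! (fibres-unique F) (mk⇔ to from))
    where
    to : ∀ {X} → X ∈ F → X ∈ fibres F
    to {X} X∈F with embed-κ X
    ... | b , eq = ∈-concat⁺′ (∈-filter⁺ (_∈? F) (subst (_∈ pair (κ X)) (sym eq) (embed∈pair b (κ X))) X∈F)
                              (∈-map⁺ (fibre F) (subsets-complete (κ X)))
    from : ∀ {X} → X ∈ fibres F → X ∈ F
    from X∈ with ∈-concat⁻′ (map (fibre F) (subsets m)) X∈
    ... | _ , X∈fib , fib∈ with ∈-map⁻ (fibre F) fib∈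
    ... | Z , _ , refl = proj₂ (∈-filter⁻ (_∈? F) {xs = pair Z} X∈fib)

  multiplicities : List (Subset (suc m)) → List ℕ
  multiplicities F = map (length ∘ fibre F) (subsets m)

  rainbow-esym : Unique F → ∀ s → weight rainbow s F ≡ esym (multiplicities F) s
  rainbow-esym {F} F! s = ≡-trans
    (weight-↭ rainbow-↭ s (fibres-↭ F!))
    (weight-rainbow-blocks (fibre F) (fibre-κ F) (subsets-unique m) s)

  multiplicities-sum : Unique F → sum (multiplicities F) ≡ length F
  multiplicities-sum {F} F! = begin
    sum (multiplicities F)                     ≡⟨ cong sum (map-∘ (subsets m)) ⟩
    sum (map length (map (fibre F) (subsets m))) ≡⟨ length-concat (map (fibre F) (subsets m)) ⟨
    length (fibres F)                          ≡⟨ ↭-length (fibres-↭ F!) ⟨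
    length F ∎
    where open ≡-Reasoning

  multiplicities-≤2 : ∀ F → All (_≤ 2) (multiplicities F)
  multiplicities-≤2 F = All.map⁺ (All.universal (λ Z → length-filter (_∈? F) (pair Z)) (subsets m))

  multiplicities-≥1 : (∀ Z → ∃[ b ] embed b Z ∈ F) → All (1 ≤_) (multiplicities F)
  multiplicities-≥1 {F} hit = All.map⁺ (All.universal at-least-one (subsets m))
    where
    at-least-one : ∀ Z → 1 ≤ length (fibre F Z)
    at-least-one Z with hit Z
    ... | b , ∈F = filter-some (_∈? F) (lose (embed∈pair b Z) ∈F)

  -- Both multiplicity lists run over all pairs and have the same sum. That of `G` has no zeros
  -- because `G` hits every pair, so `esym-balanced` compares them; for `G` the rainbow bound is
  -- attained.
  optimal : Unique F → Unique G → length F ≡ length G →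
    (∀ Z → ∃[ b ] embed b Z ∈ G) → AlmostIntersecting G →
    ∀ s → numIntersecting s F ≤ numIntersecting s G
  optimal {F} {G} F! G! len≡ hit G≈ s = begin
    numIntersecting s F        ≤⟨ numIntersecting≤rainbow F! s ⟩
    weight rainbow s F         ≡⟨ rainbow-esym F! s ⟩
    esym (multiplicities F) s  ≤⟨ esym-balanced (multiplicities-≤2 F) (multiplicities-≤2 G)
                                    (multiplicities-≥1 hit)
                                    (≡-trans (length-map _ (subsets m)) (sym (length-map _ (subsets m))))
                                    (≡-trans (multiplicities-sum F!) (≡-trans len≡ (sym (multiplicities-sum G!)))) s ⟩
    esym (multiplicities G) s  ≡⟨ rainbow-esym G! s ⟨
    weight rainbow s G         ≤⟨ rainbow≤numIntersecting G≈ s ⟩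
    numIntersecting s G ∎
    where open ≤-Reasoning

-- Layers of the cube, and the supply of sets available for doubling.

branch-All : {P : Subset (suc m) → Set} {𝒳 𝒴 : List (Subset m)} →
  All (P ∘ (inside ∷_)) 𝒳 → All (P ∘ (outside ∷_)) 𝒴 → All P (branch 𝒳 𝒴)
branch-All P𝒳 P𝒴 = All.++⁺ (All.map⁺ P𝒳) (All.map⁺ P𝒴)

layer : (m j : ℕ) → List (Subset m)
layer m       zero    = ⊥ ∷ []
layer zero    (suc j) = []
layer (suc m) (suc j) = branch (layer m j) (layer m (suc j))

layer-unique : ∀ m j → Unique (layer m j)
layer-unique m       zero    = [] ∷ []
layer-unique zero    (suc j) = []
layer-unique (suc m) (suc j) = branch-unique (layer-unique m j) (layer-unique m (suc j))

layer-card : ∀ m j → All (λ Z → ∣ Z ∣ ≡ j) (layer m j)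
layer-card m       zero    = _∷_ {x = ⊥} (∣⊥∣≡0 m) []
layer-card zero    (suc j) = []
layer-card (suc m) (suc j) = branch-All (All.map (cong suc) (layer-card m j)) (layer-card m (suc j))

layer-length : ∀ m j → length (layer m j) ≡ m C j
layer-length m       zero    = sym (≡-trans (nCk≡nC[n∸k] {0} {m} z≤n) (nCn≡1 m))
layer-length zero    (suc j) = sym (k>n⇒nCk≡0 (s≤s (z≤n {j})))
layer-length (suc m) (suc j) = begin
  length (layer (suc m) (suc j))             ≡⟨ branch-length (layer m j) _ ⟩
  length (layer m j) + length (layer m (suc j)) ≡⟨ cong₂ _+_ (layer-length m j) (layer-length m (suc j)) ⟩
  m C j + m C suc j                          ≡⟨ nCk+nC[k+1]≡[n+1]C[k+1] m j ⟩
  suc m C suc j ∎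
  where open ≡-Reasoning

-- With the point 0 put in front this becomes the set Y, so k = t - 2 and k + r = n - 1.
initial : ∀ k r → Subset (k + r)
initial zero    r = ⊥
initial (suc k) r = inside ∷ initial k r

initial-card : ∀ k r → ∣ initial k r ∣ ≡ k
initial-card zero    r = ∣⊥∣≡0 r
initial-card (suc k) r = cong suc (initial-card k r)

-- These are the sets of size k + 1 that do not contain `initial k r`. A set without the first point
-- qualifies outright; one with it is decided by the remaining points. For k = 0 there are none, as
-- every set contains the empty set.
candidates : ∀ k r → List (Subset (k + r))
candidates zero    r = []
candidates (suc k) r = branch (candidates k r) (layer (k + r) (2 + k))

candidates-unique : ∀ k r → Unique (candidates k r)
candidates-unique zero    r = []
candidates-unique (suc k) r = branch-unique (candidates-unique k r) (layer-unique (k + r) (2 + k))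

candidates-card : ∀ k r → All (λ Z → ∣ Z ∣ ≡ suc k) (candidates k r)
candidates-card zero    r = []
candidates-card (suc k) r = branch-All (All.map (cong suc) (candidates-card k r)) (layer-card (k + r) (2 + k))

candidates-⊉ : ∀ k r → All (λ Z → initial k r ⊈ Z) (candidates k r)
candidates-⊉ zero    r = []
candidates-⊉ (suc k) r = branch-All
  (All.map inside-⊈ (candidates-⊉ k r))
  (All.universal (λ Z W⊆Z → zero∉ (W⊆Z here)) _)
  where
  inside-⊈ : {Z : Subset (k + r)} → initial k r ⊈ Z → (inside ∷ initial k r) ⊈ (inside ∷ Z)
  inside-⊈ W⊈Z W⊆Z = W⊈Z (drop-∷-⊆ W⊆Z)
  zero∉ : {Z : Subset (k + r)} → zero ∉ (outside ∷ Z)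
  zero∉ ()

-- Among all sets of size k + 1, exactly r contain the initial k-set, one for each further point.
-- The induction is Pascal's rule.
candidates-length : ∀ k r → length (candidates k r) + r ≡ (k + r) C suc k
candidates-length zero    r = sym (nC1≡n r)
candidates-length (suc k) r = begin
  length (candidates (suc k) r) + r
    ≡⟨ cong (_+ r) (branch-length (candidates k r) _) ⟩
  length (candidates k r) + length (layer (k + r) (2 + k)) + r
    ≡⟨ exchange (length (candidates k r)) _ r ⟩
  length (candidates k r) + r + length (layer (k + r) (2 + k))
    ≡⟨ cong₂ _+_ (candidates-length k r) (layer-length (k + r) (2 + k)) ⟩
  (k + r) C suc k + (k + r) C (2 + k)
    ≡⟨ nCk+nC[k+1]≡[n+1]C[k+1] (k + r) (suc k) ⟩
  (suc k + r) C (2 + k) ∎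
  where
  open ≡-Reasoning
  exchange : ∀ a b c → a + b + c ≡ a + c + b
  exchange = solve-∀

-- The extremal family.

⊆∧∣≥∣⇒≡ : {X Y : Subset m} → X ⊆ Y → ∣ Y ∣ ≤ ∣ X ∣ → X ≡ Y
⊆∧∣≥∣⇒≡ {X = X} X⊆Y ∣Y∣≤∣X∣ = ⊆-antisym X⊆Y λ {x} x∈Y →
  decidable-stable (x Subset.∈? X) λ x∉X → <⇒≱ (p⊂q⇒∣p∣<∣q∣ (X⊆Y , x , x∈Y , x∉X)) ∣Y∣≤∣X∣

disjoint⇒⊆∁ : {X Y : Subset m} → ¬ Nonempty (X ∩ Y) → X ⊆ ∁ Y
disjoint⇒⊆∁ X∩Y=∅ {x} x∈X = x∉p⇒x∈∁p λ x∈Y → X∩Y=∅ (x , x∈p∩q⁺ (x∈X , x∈Y))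

∩-nonempty-comm : (X Y : Subset m) → Nonempty (X ∩ Y) → Nonempty (Y ∩ X)
∩-nonempty-comm X Y = subst Nonempty (∩-comm X Y)

module Family {m k} (W : Subset m) (∣W∣≡k : ∣ W ∣ ≡ k) (3+2k≤m : 3 + 2 * k ≤ m) where

  -- An index `Z` stands for the set X consisting of 0 and `Z`, so sizes drop by one: 2 + k ≤ |Z|
  -- means t < |X|, where t = k + 2.
  Kept : Subset m → Set
  Kept Z = W ⊆ Z ⊎ 2 + k ≤ ∣ Z ∣

  kept? : Decidable Kept
  kept? Z = (W ⊆? Z) ⊎-dec (2 + k ≤? ∣ Z ∣)

  -- The pairs that supply both members. The index `W` is kept, so doubling adds ∁ Y; the others are
  -- not kept, so doubling adds a t-set through 0.
  Doubled : Subset m → Set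
  Doubled Z = Z ≡ W ⊎ (∣ Z ∣ ≡ suc k × W ⊈ Z)

  chosen other : Subset m → Subset (suc m)
  chosen Z = embed (does (kept? Z)) Z
  other  Z = embed (not (does (kept? Z))) Z

  family : List (Subset m) → List (Subset (suc m))
  family D = map chosen (subsets m) ++ map other D

  family-length : ∀ D → length (family D) ≡ 2 ^ m + length D
  family-length D = ≡-trans (length-++ (map chosen (subsets m)))
    (cong₂ _+_ (≡-trans (length-map chosen (subsets m)) (subsets-length m)) (length-map other D))

  embed-injectiveʳ : ∀ b b′ {Y Z : Subset m} → embed b Y ≡ embed b′ Z → Y ≡ Z
  embed-injectiveʳ b b′ {Y} {Z} eq =
    ≡-trans (sym (κ-embed b Y)) (≡-trans (cong κ eq) (κ-embed b′ Z))

  embed≢embed-not : ∀ b (Z : Subset m) → embed b Z ≢ embed (not b) Z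
  embed≢embed-not true  Z ()
  embed≢embed-not false Z ()

  family-unique : ∀ {D} → Unique D → Unique (family D)
  family-unique D! = Unique.++⁺
    (Unique.map⁺ (embed-injectiveʳ _ _) (subsets-unique m))
    (Unique.map⁺ (embed-injectiveʳ _ _) D!)
    disjoint
    where
    disjoint : Disjoint (map chosen (subsets m)) (map other _)
    disjoint (X∈ , X∈′) with ∈-map⁻ chosen X∈ | ∈-map⁻ other X∈′
    ... | Y , _ , refl | Z , _ , eq
      with embed-injectiveʳ (does (kept? Y)) (not (does (kept? Z))) eq
    ... | refl = embed≢embed-not (does (kept? Y)) Y eq

  chosen∈family : ∀ D Z → chosen Z ∈ family D
  chosen∈family D Z = ∈-++⁺ˡ (∈-map⁺ chosen (subsets-complete Z))

  -- One description for chosen and added members, sorted by whether they contain 0. The indices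
  -- admissible for both values are exactly the doubled ones.
  Admissible : Bool → Subset m → Set
  Admissible true  Z = W ⊆ Z ⊎ suc k ≤ ∣ Z ∣
  Admissible false Z = Z ≡ W ⊎ (W ⊈ Z × ∣ Z ∣ ≤ suc k)

  chosen-admissible : ∀ Z (kept : Dec (Kept Z)) → Admissible (does kept) Z
  chosen-admissible Z (yes (inj₁ W⊆Z))  = inj₁ W⊆Z
  chosen-admissible Z (yes (inj₂ 2+k≤)) = inj₂ (<⇒≤ 2+k≤)
  chosen-admissible Z (no ¬kept)        =
    inj₂ ((λ W⊆Z → ¬kept (inj₁ W⊆Z)) , ≤-pred (≰⇒> (¬kept ∘ inj₂)))

  other-admissible : ∀ {Z} → Doubled Z → (kept : Dec (Kept Z)) → Admissible (not (does kept)) Z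
  other-admissible (inj₁ Z≡W)        (yes _)           = inj₁ Z≡W
  other-admissible (inj₁ refl)       (no ¬kept)        = ⊥-elim (¬kept (inj₁ ⊆-refl))
  other-admissible (inj₂ (_ , W⊈Z))  (yes (inj₁ W⊆Z))  = ⊥-elim (W⊈Z W⊆Z)
  other-admissible (inj₂ (∣Z∣≡ , _)) (yes (inj₂ 2+k≤)) = contradiction (subst (2 + k ≤_) ∣Z∣≡ 2+k≤) 1+n≰n
  other-admissible (inj₂ (∣Z∣≡ , _)) (no _)            = inj₂ (≤-reflexive (sym ∣Z∣≡))

  family-admissible : ∀ {D X} → All Doubled D → X ∈ family D →
    ∃[ b ] ∃[ Z ] (X ≡ embed b Z × Admissible b Z)
  family-admissible D-doubled X∈ with ∈-++⁻ (map chosen (subsets m)) X∈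
  ... | inj₁ X∈chosen = let Z , _ , X≡ = ∈-map⁻ chosen X∈chosen in
    _ , Z , X≡ , chosen-admissible Z (kept? Z)
  ... | inj₂ X∈other  = let Z , Z∈D , X≡ = ∈-map⁻ other X∈other in
    _ , Z , X≡ , other-admissible (All.lookup D-doubled Z∈D) (kept? Z)

  -- The inclusion says that the set through 0 indexed by `Y` is disjoint from the complement
  -- indexed by `Z`; the conclusion makes the two complementary. If W ⊆ Y then W ⊆ Z, which forces Z
  -- = W. Otherwise `Y` has at least k + 1 elements and `Z` at most that many.
  large-⊆-small : ∀ {Y Z} → Admissible true Y → Admissible false Z → Y ⊆ Z → Y ≡ Z
  large-⊆-small (inj₁ W⊆Y) (inj₁ refl) Y⊆W = ⊆-antisym Y⊆W W⊆Y
  large-⊆-small (inj₂ k<∣Y∣) (inj₁ refl) Y⊆W =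
    contradiction (≤-trans k<∣Y∣ (≤-trans (p⊆q⇒∣p∣≤∣q∣ Y⊆W) (≤-reflexive ∣W∣≡k))) 1+n≰n
  large-⊆-small (inj₁ W⊆Y) (inj₂ (W⊈Z , _)) Y⊆Z = ⊥-elim (W⊈Z (⊆-trans W⊆Y Y⊆Z))
  large-⊆-small (inj₂ k<∣Y∣) (inj₂ (_ , ∣Z∣≤1+k)) Y⊆Z = ⊆∧∣≥∣⇒≡ Y⊆Z (≤-trans ∣Z∣≤1+k k<∣Y∣)

  small-card : ∀ {Z} → Admissible false Z → ∣ Z ∣ ≤ suc k
  small-card (inj₁ refl)        = ≤-trans (≤-reflexive ∣W∣≡k) (n≤1+n k)
  small-card (inj₂ (_ , ∣Z∣≤)) = ∣Z∣≤

  -- If the complements were disjoint, `Y` and `Z` would cover all m points, but together they have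
  -- at most 2k + 2 elements. The assumption m ≥ 2k + 3 amounts to n ≥ 2t.
  small-∁-meet : ∀ {Y Z} → Admissible false Y → Admissible false Z → Nonempty (∁ Y ∩ ∁ Z)
  small-∁-meet {Y} {Z} Y-small Z-small with nonempty? (∁ Y ∩ ∁ Z)
  ... | yes meet = meet
  ... | no  disj = contradiction (begin-strict
    m                   ≤⟨ m≤n+m∸n m ∣ Y ∣ ⟩
    ∣ Y ∣ + (m ∸ ∣ Y ∣) ≡⟨ cong (∣ Y ∣ +_) (∣∁p∣≡n∸∣p∣ Y) ⟨
    ∣ Y ∣ + ∣ ∁ Y ∣     ≤⟨ +-monoʳ-≤ ∣ Y ∣ (p⊆q⇒∣p∣≤∣q∣ (disjoint⇒⊆∁ disj)) ⟩
    ∣ Y ∣ + ∣ ∁ (∁ Z) ∣ ≡⟨ cong (λ V → ∣ Y ∣ + ∣ V ∣) (∁-involutive Z) ⟩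
    ∣ Y ∣ + ∣ Z ∣       ≤⟨ +-mono-≤ (small-card Y-small) (small-card Z-small) ⟩
    suc k + suc k       <⟨ ≤-reflexive (regroup k) ⟩
    3 + 2 * k           ≤⟨ 3+2k≤m ⟩
    m ∎) (<-irrefl refl)
    where
    open ≤-Reasoning
    regroup : ∀ k → suc (suc k + suc k) ≡ 3 + 2 * k
    regroup = solve-∀

  large-small : ∀ {Y Z} → Admissible true Y → Admissible false Z →
    Nonempty (Y ∩ ∁ Z) ⊎ Y ≡ Z
  large-small {Y} {Z} Y-large Z-small with nonempty? (Y ∩ ∁ Z)
  ... | yes meet = inj₁ meet
  ... | no  disj = inj₂ (large-⊆-small Y-large Z-small
          (subst (Y ⊆_) (∁-involutive Z) (disjoint⇒⊆∁ disj)))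

  admissible-meet : ∀ b {Y} b′ {Z} → Admissible b Y → Admissible b′ Z →
    Nonempty (embed b Y ∩ embed b′ Z) ⊎ (κ (embed b Y) ≡ κ (embed b′ Z) × embed b Y ≢ embed b′ Z)
  admissible-meet true  true  _ _ = inj₁ (zero , here)
  admissible-meet false false Y-small Z-small with small-∁-meet Y-small Z-small
  ... | x , x∈ = inj₁ (suc x , there x∈)
  admissible-meet true {Y} false {Z} Y-large Z-small with large-small Y-large Z-small
  ... | inj₁ (x , x∈) = inj₁ (suc x , there x∈)
  ... | inj₂ refl     = inj₂ (sym (∁-involutive Z) , λ ())
  admissible-meet false {Y} true {Z} Y-small Z-large with large-small Z-large Y-small
  ... | inj₁ meet = let x , x∈ = ∩-nonempty-comm Z (∁ Y) meet in inj₁ (suc x , there x∈)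
  ... | inj₂ refl = inj₂ (∁-involutive Z , λ ())

  family-almostIntersecting : ∀ {D} → All Doubled D → AlmostIntersecting (family D)
  family-almostIntersecting D-doubled X∈ Y∈
    with family-admissible D-doubled X∈ | family-admissible D-doubled Y∈
  ... | b , _ , refl , adm | b′ , _ , refl , adm′ = admissible-meet b b′ adm adm′

  family-optimal : ∀ {D} → Unique D → All Doubled D →
    ∀ {F} → Unique F → length F ≡ length (family D) →
    ∀ s → numIntersecting s F ≤ numIntersecting s (family D)
  family-optimal {D} D! D-doubled F! len≡ = optimal F! (family-unique D!) len≡
    (λ Z → does (kept? Z) , chosen∈family D Z) (family-almostIntersecting D-doubled)

  W∈family : ∀ D → (inside ∷ W) ∈ family D
  W∈family D = subst (λ b → embed b W ∈ family D) (dec-true (kept? W) (inj₁ ⊆-refl)) (chosen∈family D W)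

-- Fitting the size N, and the two cases of the theorem.

Solution : (t n N : ℕ) → Set
Solution t n N = ∃[ 𝒜 ] (Unique {A = Subset n} 𝒜 × length 𝒜 ≡ N
  × (∀ (s : ℕ) (ℱ : List (Subset n)) → Unique ℱ → length ℱ ≡ N →
       numIntersecting s ℱ ≤ numIntersecting s 𝒜)
  × ¬ (∃[ ℬ ] (All (λ X → ∣ X ∣ ≡ t) ℬ
         × (∀ (X : Subset n) → (X ∈ 𝒜) ⇔ ((suc t ≤ ∣ X ∣) ⊎ (X ∈ ℬ))))))

-- Covers both cases, with t = k + 2 and n = k + r + 1. The upper bound on `N` is the capacity of
-- the construction: one member per pair, then ∁ Y, then all candidates, which number C(k + r, k +
-- 1) - r.
solution : ∀ k r N → 3 + k ≤ r → 2 ^ (k + r) < N →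
  N + r ≤ 2 ^ (k + r) + suc ((k + r) C suc k) → Solution (2 + k) (suc (k + r)) N
solution k r N 3+k≤r 2^m<N N≤ =
  family D , family-unique D! , length≡N
  , (λ s ℱ ℱ! ∣ℱ∣≡N → family-optimal D! D-doubled ℱ! (≡-trans ∣ℱ∣≡N (sym length≡N)) s)
  , not-layered
  where
  W = initial k r
  -- The number of candidates still to be doubled after the 2^(n-1) chosen members and ∁ Y.
  j = N ∸ suc (2 ^ (k + r))

  3+2k≤m : 3 + 2 * k ≤ k + r
  3+2k≤m = ≤-trans (≤-reflexive (regroup k)) (+-monoʳ-≤ k 3+k≤r)
    where
    regroup : ∀ k → 3 + 2 * k ≡ k + (3 + k)
    regroup = solve-∀

  open Family W (initial-card k r) 3+2k≤m

  N≡ : 2 ^ (k + r) + suc j ≡ N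
  N≡ = ≡-trans (+-suc (2 ^ (k + r)) j) (m+[n∸m]≡n 2^m<N)

  j≤ : j ≤ length (candidates k r)
  j≤ = +-cancelʳ-≤ r _ _ (≤-pred (+-cancelˡ-≤ (2 ^ (k + r)) _ _ (begin
    2 ^ (k + r) + suc (j + r)                       ≡⟨ +-assoc (2 ^ (k + r)) (suc j) r ⟨
    2 ^ (k + r) + suc j + r                         ≡⟨ cong (_+ r) N≡ ⟩
    N + r                                           ≤⟨ N≤ ⟩
    2 ^ (k + r) + suc ((k + r) C suc k)             ≡⟨ cong (λ c → 2 ^ (k + r) + suc c) (candidates-length k r) ⟨
    2 ^ (k + r) + suc (length (candidates k r) + r) ∎)))
    where open ≤-Reasoning

  D : List (Subset (k + r))
  D = W ∷ take j (candidates k r)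

  D! : Unique D
  D! = All.take⁺ j (All.map (λ W⊈Z W≡Z → W⊈Z (subst (W ⊆_) W≡Z ⊆-refl)) (candidates-⊉ k r))
     ∷ Unique.take⁺ j (candidates-unique k r)

  D-doubled : All Doubled D
  D-doubled = inj₁ refl ∷ All.take⁺ j (All.zipWith inj₂ (candidates-card k r , candidates-⊉ k r))

  length≡N : length (family D) ≡ N
  length≡N = begin
    length (family D)        ≡⟨ family-length D ⟩
    2 ^ (k + r) + length D   ≡⟨ cong (λ l → 2 ^ (k + r) + suc l)
                                  (≡-trans (length-take j (candidates k r)) (m≤n⇒m⊓n≡m j≤)) ⟩
    2 ^ (k + r) + suc j      ≡⟨ N≡ ⟩
    N ∎
    where open ≡-Reasoning

  not-layered : ¬ (∃[ ℬ ] (All (λ X → ∣ X ∣ ≡ 2 + k) ℬ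
    × (∀ X → (X ∈ family D) ⇔ ((3 + k ≤ ∣ X ∣) ⊎ (X ∈ ℬ)))))
  -- The set Y has t - 1 elements: too few for the upper layers, and the wrong size for `ℬ`.
  not-layered (ℬ , ℬ-card , iff) with Equivalence.to (iff (inside ∷ W)) (W∈family D)
  ... | inj₁ 3+k≤ = 1+n≰n (≤-trans (n≤1+n _) (subst (λ c → 3 + k ≤ suc c) (initial-card k r) 3+k≤))
  ... | inj₂ W∈ℬ  = 1+n≢n (sym (≡-trans (cong suc (sym (initial-card k r))) (All.lookup ℬ-card W∈ℬ)))

-- Pascal's rule splits the central coefficient into two that are equal by symmetry. It turns half
-- of C(n, t) into C(n - 1, t - 1) when n = 2t.
central-binomial : ∀ a → 2 * ((a + suc a) C a) ≡ (suc a + suc a) C suc a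
central-binomial a = begin
  2 * (n C a)           ≡⟨ cong (n C a +_) (+-identityʳ _) ⟩
  n C a + n C a         ≡⟨ cong (n C a +_) (nCk≡nC[n∸k] (m≤m+n a (suc a))) ⟩
  n C a + n C (n ∸ a)   ≡⟨ cong (λ c → n C a + n C c) (m+n∸m≡n a (suc a)) ⟩
  n C a + n C suc a     ≡⟨ nCk+nC[k+1]≡[n+1]C[k+1] n a ⟩
  (suc a + suc a) C suc a ∎
  where
  open ≡-Reasoning
  n = a + suc a

theorem13 : (t n N : ℕ) → 1 ≤ t →
    ((n ≡ 2 * t) × (2 ^ (n ∸ 1) < N) × (2 * N + 2 * t ≤ 2 * 2 ^ (n ∸ 1) + n C t))
    ⊎ ((n ≡ 2 * t + 1) × (2 ^ (n ∸ 1) < N) × (N + t + 1 ≤ 2 ^ (n ∸ 1) + (n ∸ 1) C (t ∸ 1))) →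
    ∃[ 𝒜 ] (Unique {A = Subset n} 𝒜 × length 𝒜 ≡ N
    × (∀ (s : ℕ) (ℱ : List (Subset n)) → Unique ℱ → length ℱ ≡ N →
    numIntersecting s ℱ ≤ numIntersecting s 𝒜)
    × ¬ (∃[ ℬ ] (All (λ X → ∣ X ∣ ≡ t) ℬ
    × (∀ (X : Subset n) → (X ∈ 𝒜) ⇔ ((suc t ≤ ∣ X ∣) ⊎ (X ∈ ℬ))))))
-- For t = 1 the range is empty: `N` would satisfy 2 < N ≤ 2 when n = 2, and 4 < N ≤ 3 when n = 3.
theorem13 1 .2 N _ (inj₁ (refl , 2<N , ≤6)) =
  contradiction (≤-trans (+-monoˡ-≤ 2 (*-monoʳ-≤ 2 2<N)) ≤6) (<⇒≱ (m≤m+n 7 1))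
theorem13 1 .3 N _ (inj₂ (refl , 4<N , ≤5)) =
  contradiction (≤-trans (+-monoˡ-≤ 1 (+-monoˡ-≤ 1 4<N)) ≤5) (<⇒≱ (m≤m+n 6 1))
theorem13 (suc (suc k)) n N _ (inj₁ (n≡ , 2^<N , N≤)) = even (≡-trans n≡ (regroup k)) 2^<N N≤
  where
  regroup : ∀ k → 2 * (2 + k) ≡ suc (k + (3 + k))
  regroup = solve-∀

  even : ∀ {n} → n ≡ suc (k + (3 + k)) → 2 ^ (n ∸ 1) < N →
    2 * N + 2 * (2 + k) ≤ 2 * 2 ^ (n ∸ 1) + n C (2 + k) → Solution (2 + k) n N
  -- Here r = t + 1, so the capacity bound reads N + t ≤ 2^(n-1) + C(n - 1, t - 1); it is proved
  -- after doubling, which removes the half from the hypothesis.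
  even refl 2^<N N≤ = solution k (3 + k) N ≤-refl 2^<N (begin
    N + (3 + k)                  ≡⟨ +-suc N (2 + k) ⟩
    suc (N + (2 + k))            ≤⟨ s≤s (*-cancelˡ-≤ 2 (begin
      2 * (N + (2 + k))                    ≡⟨ *-distribˡ-+ 2 N (2 + k) ⟩
      2 * N + 2 * (2 + k)                  ≤⟨ N≤ ⟩
      2 * 2 ^ μ + suc μ C (2 + k)          ≡⟨ cong (λ l → 2 * 2 ^ μ + suc l C (2 + k)) (+-suc k (2 + k)) ⟩
      2 * 2 ^ μ + (2 + k + (2 + k)) C (2 + k)
        ≡⟨ cong (2 * 2 ^ μ +_) (central-binomial (suc k)) ⟨
      2 * 2 ^ μ + 2 * ((suc k + (2 + k)) C suc k)
        ≡⟨ cong (λ l → 2 * 2 ^ μ + 2 * (l C suc k)) (+-suc k (2 + k)) ⟨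
      2 * 2 ^ μ + 2 * (μ C suc k)          ≡⟨ *-distribˡ-+ 2 (2 ^ μ) _ ⟨
      2 * (2 ^ μ + μ C suc k) ∎)) ⟩
    suc (2 ^ μ + μ C suc k)      ≡⟨ +-suc (2 ^ μ) _ ⟨
    2 ^ μ + suc (μ C suc k) ∎)
    where
    open ≤-Reasoning
    μ = k + (3 + k)
theorem13 (suc (suc k)) n N _ (inj₂ (n≡ , 2^<N , N≤)) = odd (≡-trans n≡ (regroup k)) 2^<N N≤
  where
  regroup : ∀ k → 2 * (2 + k) + 1 ≡ suc (k + (4 + k))
  regroup = solve-∀

  odd : ∀ {n} → n ≡ suc (k + (4 + k)) → 2 ^ (n ∸ 1) < N →
    N + (2 + k) + 1 ≤ 2 ^ (n ∸ 1) + (n ∸ 1) C suc k → Solution (2 + k) n N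
  -- Here r = t + 2, and the hypothesis is the capacity bound with 1 subtracted on both sides.
  odd refl 2^<N N≤ = solution k (4 + k) N (n≤1+n _) 2^<N (begin
    N + (4 + k)             ≡⟨ shift N k ⟩
    suc (N + (2 + k) + 1)   ≤⟨ s≤s N≤ ⟩
    suc (2 ^ μ + μ C suc k) ≡⟨ +-suc (2 ^ μ) _ ⟨
    2 ^ μ + suc (μ C suc k) ∎)
    where
    open ≤-Reasoning
    μ = k + (4 + k)
    shift : ∀ N k → N + (4 + k) ≡ suc (N + (2 + k) + 1)
    shift = solve-∀
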